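{- (ZFC) Let $X \subseteq {}^\omega 2$ with $|X| = \mathfrak{c}$. Then $X$ is not $s_0$-shiftable, i.e., there is a $Y \in s_0$ such that $X + Y = {}^\omega 2$.
   Context: ${}^\omega 2$ is the Cantor space, regarded as a group under bitwise addition modulo $2$, denoted $+$; $\mathfrak{c} = 2^{\aleph_0}$. For $X,Y\subseteq {}^\omega 2$ and $t\in{}^\omega 2$, $X+Y=\{x+y: x\in X, y\in Y\}$ and $X+t=\{x+t:x\in X\}$. A set $Y \subseteq {}^\omega 2$ is Marczewski null ($Y \in s_0$) if for every perfect set $P \subseteq {}^\omega 2$ there is a perfect set $Q \subseteq P$ with $Q \cap Y = \emptyset$. For a collection $\mathcal I\subseteq\mathcal P({}^\omega 2)$, a set $X \subseteq {}^\omega 2$ is $\mathcal I$-shiftable if $X + Y \neq {}^\omega 2$ for every $Y \in \mathcal I$. -}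

module Defs where

open import Data.Bool.Base using (Bool; _xor_)
open import Data.Nat.Base using (ℕ; _<_)
open import Data.Product using (Σ; ∃; _×_; proj₁)
open import Function.Bundles using (Bijection)
open import Level using (Level; 0ℓ; suc)
open import Relation.Binary.Bundles using (Setoid)
open import Relation.Binary.PropositionalEquality using (_≡_; _≢_; setoid)
import Relation.Binary.Construct.On as On
open import Relation.Nullary using (¬_)
open import Relation.Unary using (Pred; _∈_; _⊆_; _≐_; _∩_; U; Empty; Satisfiable)

Cantor : Set
Cantor = ℕ → Bool

infixl 6 _⊕_ _⊞_

_⊕_ : Cantor → Cantor → Cantor
(x ⊕ y) n = x n xor y n

-- Under excluded middle, every predicate on Cantor, at any universe level, is
-- equivalent to a Bool-valued one, so level 0ℓ loses no subsets.
Subset : Set₁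
Subset = Pred Cantor 0ℓ

_⊞_ : Subset → Subset → Subset
(X ⊞ Y) z = ∃ λ x → ∃ λ y → x ∈ X × y ∈ Y × z ≡ x ⊕ y

-- For fixed x, the sets { y | Agree n x y } are the basic open neighbourhoods
-- of x in the product topology.
Agree : ℕ → Cantor → Cantor → Set
Agree n x y = ∀ k → k < n → x k ≡ y k

Closed : Subset → Set
Closed P = ∀ x → (∀ n → ∃ λ y → y ∈ P × Agree n x y) → x ∈ P

NoIsolatedPoints : Subset → Set
NoIsolatedPoints P =
  ∀ x → x ∈ P → ∀ n → ∃ λ y → y ∈ P × y ≢ x × Agree n x y

-- Perfect sets are nonempty; otherwise every set would be Marczewski null.
record Perfect (P : Subset) : Set where
  field
    nonempty         : Satisfiable P
    closed           : Closed P
    noIsolatedPoints : NoIsolatedPoints P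

s₀ : Pred Subset (suc 0ℓ)
s₀ Y = ∀ P → Perfect P → ∃ λ Q → Perfect Q × Q ⊆ P × Empty (Q ∩ Y)

Shiftable : {ℓ : Level} → Pred Subset ℓ → Pred Subset _
Shiftable I X = ∀ Y → Y ∈ I → ¬ (X ⊞ Y ≐ U)

-- The elements of X are compared by their underlying points only, so that
-- different proofs of x ∈ X do not contribute to the cardinality of X.
elements : Subset → Setoid 0ℓ 0ℓ
elements X = On.setoid {B = Σ Cantor X} (setoid Cantor) proj₁

-- |X| = 𝔠, where 𝔠 = 2^ℵ₀ is the cardinality of Cantor.
HasSizeContinuum : Subset → Set
HasSizeContinuum X = Bijection (setoid Cantor) (elements X)

-- The statement is a theorem of ZFC, so it takes two classical principles as
-- hypotheses: function extensionality, which makes _≡_ on Cantor the equality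
-- of sequences, and excluded middle for all types.  The latter also supplies
-- choice: Dec A yields an actual element of A whenever A is not empty, so
-- (∀ x → ¬ ¬ ∃ (R x)) gives ∃ λ f → ∀ x → R x (f x).

{-# OPTIONS --safe #-}

-- Rank the points of the Cantor space along a well-ordered chain of thin sets, that
-- is, of sets that generate fewer than continuum many points.  Suppose that every perfect P has
-- a perfect subset Q_P such that no X + z is covered by the Q_P with P of rank at
-- most that of z (perfect sets being coded by points).  Pick x_z ∈ X with x_z + z
-- outside all these Q_P.  Then Y = { x_z + z } satisfies X + Y = 2^ω, and each
-- Q_P ∩ Y is covered by a thin set, hence misses one of continuum many disjoint
-- perfect subsets of Q_P.
--
-- If the Q_P can be chosen so that all X ∩ (Q_P + t) are covered by one member of the
-- chain, then they are as required.  Otherwise shrink each P so that the sizes of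
-- the sets X ∩ (P + t) no longer drop on passing to perfect subsets, and call the
-- set of ranks they exceed its value.  Some translate of each subset Q of a suitable P
-- meets X in a large set; choose continuum many such Q_r whose points first
-- differ at levels in A_r, for an almost disjoint family (A_r), and choose Q_P so
-- that it has a perfect subset with differences in A_r for at most one r.  If
-- (Q_r + t) ∩ (Q_P + z) is not covered, then this closed set contains a perfect
-- set, whose differences lie in A_r; so only one r is lost for each P.  Sets of
-- different value have covered intersections, so one family (A_r) for each value
-- suffices; this takes care of singular 2^ℵ₀.
module Submission where

open import Defs
open import Axiom.ExcludedMiddle using (ExcludedMiddle)
open import Axiom.Extensionality.Propositional using (Extensionality)
open import Data.Bool.Base using (Bool; true; false; not; _xor_)
open import Data.Bool.Properties using (xor-assoc; xor-identityʳ; xor-same; ¬-not; not-¬)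
  renaming (_≟_ to _≟ᵇ_)
open import Data.Nat.Base using (ℕ; zero; suc; _≤_; _<_; z≤n; s≤s; _⊔_)
open import Data.Nat.Binary.Base using (ℕᵇ; zero; 2[1+_]; 1+[2_]; toℕ)
open import Data.Nat.Binary.Properties using (toℕ-injective; 2[1+_]-injective; 1+[2_]-injective)
open import Data.Nat.Induction using (<-wellFounded)
open import Data.Nat.Properties
  using (suc-injective; ≤-refl; ≤-trans; ≤-pred; <⇒≤; <-≤-trans; ≤-<-trans; ≮⇒≥; <⇒≱; n<1+n;
         n≤1+n; m≤n*m; m≤m⊔n; m≤n⊔m; m≤n⇒m<n∨m≡n; <-cmp)
open import Data.Product using (Σ; ∃; _×_; _,_; proj₁; proj₂)
open import Data.Sum.Base using (_⊎_; inj₁; inj₂; [_,_]′)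
open import Data.Unit.Base using (tt)
open import Function.Base using (_∘_; id; const)
open import Function.Bundles using (Bijection)
open import Induction.WellFounded using (Acc; acc; WellFounded)
open import Level using (Level; 0ℓ)
open import Relation.Binary.Definitions using (tri<; tri≈; tri>)
open import Relation.Binary.PropositionalEquality
  using (_≡_; _≢_; refl; sym; trans; cong; cong₂; subst; module ≡-Reasoning)
open import Relation.Nullary using (¬_; yes; no; contradiction)
open import Relation.Nullary.Decidable using (True; toWitness; fromWitness; isYes; decidable-stable)
open import Relation.Unary using (Pred; _∈_; _∉_; _⊆_; _≐_; _∩_; U; ｛_｝)

module _ (em : ∀ ℓ → ExcludedMiddle ℓ) (ext : ∀ a b → Extensionality a b) where

  private
    variable
      a b ℓ : Level

  -- Classical reasoning

  stable : {P : Set a} → ¬ ¬ P → P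
  stable {a} = decidable-stable (em a)

  ¬∀⇒∃¬ : {A : Set a} {P : A → Set b} → ¬ (∀ x → P x) → ∃ λ x → ¬ P x
  ¬∀⇒∃¬ ¬all = stable λ none → ¬all λ x → stable λ ¬px → none (x , ¬px)

  minimal : {A : Set a} {_<′_ : A → A → Set b} → WellFounded _<′_ →
            (P : A → Set ℓ) → ∃ P → ∃ λ x → P x × ∀ y → y <′ x → ¬ P y
  minimal {_<′_ = _<′_} wf P (x , px) = go x (wf x) px
    where
    go : ∀ x → Acc _<′_ x → P x → ∃ λ x → P x × ∀ y → y <′ x → ¬ P y
    go x (acc rs) px with em _ {P = ∃ λ y → y <′ x × P y}
    ... | yes (y , y<x , py) = go y (rs y<x) py
    ... | no  none           = x , px , λ y y<x py → none (y , y<x , py)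

  opaque
    char : {A : Set a} → (A → Set ℓ) → A → Bool
    char P x = isYes (em _ {P = P x})

    char⁺ : {A : Set a} {P : A → Set ℓ} {x : A} → P x → char P x ≡ true
    char⁺ {P = P} {x} px with em _ {P = P x}
    ... | yes _  = refl
    ... | no ¬px = contradiction px ¬px

    char⁻ : {A : Set a} {P : A → Set ℓ} {x : A} → char P x ≡ true → P x
    char⁻ {P = P} {x} eq with em _ {P = P x}
    ... | yes px = px
    ... | no  _  with () ← eq

  ⇔⇒≡ : {b c : Bool} → (b ≡ true → c ≡ true) → (c ≡ true → b ≡ true) → b ≡ c
  ⇔⇒≡ {true}  {c}     f g = sym (f refl)
  ⇔⇒≡ {false} {true}  f g = g refl
  ⇔⇒≡ {false} {false} f g = refl

  -- Zermelo's well-ordering theorem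

  module WellOrder {A : Set} (default : A) where

    -- Bool-valued subsets keep the quantification over Tower members below in Set.
    Sub : Set
    Sub = A → Bool

    infix 4 _∈ᵇ_ _⊑_ _≺_

    _∈ᵇ_ : A → Sub → Set
    x ∈ᵇ S = S x ≡ true

    _⊑_ : Sub → Sub → Set
    S ⊑ T = ∀ x → x ∈ᵇ S → x ∈ᵇ T

    ⊑-antisym : ∀ {S T} → S ⊑ T → T ⊑ S → S ≡ T
    ⊑-antisym S⊑T T⊑S = ext _ _ λ x → ⇔⇒≡ (S⊑T x) (T⊑S x)

    outside : Sub → A
    outside S with em _ {P = ∃ λ x → ¬ x ∈ᵇ S}
    ... | yes (x , _) = x
    ... | no  _       = default

    outside-∉ : ∀ {S x} → ¬ x ∈ᵇ S → ¬ outside S ∈ᵇ S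
    outside-∉ {S} {x} x∉S with em _ {P = ∃ λ x → ¬ x ∈ᵇ S}
    ... | yes (_ , y∉S) = y∉S
    ... | no  none      = λ _ → none (x , x∉S)

    _⁺ : Sub → Sub
    S ⁺ = char λ x → x ∈ᵇ S ⊎ x ≡ outside S

    ⋃ : {I : Set} → (I → Sub) → Sub
    ⋃ g = char λ x → ∃ λ i → x ∈ᵇ g i

    -- These become the initial segments of the order: `sup` of the empty family starts the tower,
    -- and `next` adds one chosen point.
    data Tower : Sub → Set₁ where
      next : ∀ {S} → Tower S → Tower (S ⁺)
      sup  : {I : Set} (g : I → Sub) → (∀ i → Tower (g i)) → Tower (⋃ g)

    ⊑-next : ∀ S → S ⊑ S ⁺
    ⊑-next S x x∈S = char⁺ (inj₁ x∈S)

    ⊑-⋃ : {I : Set} (g : I → Sub) (i : I) → g i ⊑ ⋃ g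
    ⊑-⋃ g i x x∈ = char⁺ (i , x∈)

    ⋃-⊑ : {I : Set} (g : I → Sub) {T : Sub} → (∀ i → g i ⊑ T) → ⋃ g ⊑ T
    ⋃-⊑ g sub x x∈ with i , x∈gi ← char⁻ x∈ = sub i x x∈gi

    Comparable : Sub → Set₁
    Comparable S = ∀ {T} → Tower T → T ⊑ S ⊎ S ⊑ T

    -- The critical case is `T ⊑ S ⊑ T ⁺`: if the point added to `T` lies in `S`, then `T ⁺ ⊑ S`;
    -- otherwise `S` equals `T`.
    next-compare : ∀ {S} → Comparable S → ∀ {T} → Tower T → T ⊑ S ⊎ S ⁺ ⊑ T
    next-compare {S} cmp (next {T} t) with next-compare cmp t
    ... | inj₂ S⁺⊑T = inj₂ λ x x∈ → ⊑-next T x (S⁺⊑T x x∈)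
    ... | inj₁ T⊑S with cmp (next t)
    ...   | inj₁ T⁺⊑S = inj₁ T⁺⊑S
    ...   | inj₂ S⊑T⁺ with em _ {P = outside T ∈ᵇ S}
    ...     | yes o∈S = inj₁ λ x x∈ →
                [ T⊑S x , (λ x≡o → subst (_∈ᵇ S) (sym x≡o) o∈S) ]′ (char⁻ x∈)
    ...     | no  o∉S = inj₂ λ x → subst (λ R → x ∈ᵇ R ⁺) (⊑-antisym S⊑T T⊑S)
      where
      S⊑T : S ⊑ T
      S⊑T x x∈S = [ id , (λ x≡o → contradiction (subst (_∈ᵇ S) x≡o x∈S) o∉S) ]′
                    (char⁻ (S⊑T⁺ x x∈S))
    next-compare {S} cmp (sup g t) with em _ {P = ∃ λ i → S ⁺ ⊑ g i}
    ... | yes (i , S⁺⊑gi) = inj₂ λ x x∈ → ⊑-⋃ g i x (S⁺⊑gi x x∈)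
    ... | no  none        = inj₁ (⋃-⊑ g λ i →
            [ id , (λ S⁺⊑gi → contradiction (i , S⁺⊑gi) none) ]′ (next-compare cmp (t i)))

    comparable : ∀ {S} → Tower S → Comparable S
    comparable (next {S} s) t =
      [ (λ T⊑S → inj₁ λ x x∈ → ⊑-next S x (T⊑S x x∈)) , inj₂ ]′ (next-compare (comparable s) t)
    comparable (sup g s) {T} t with em _ {P = ∃ λ i → T ⊑ g i}
    ... | yes (i , T⊑gi) = inj₁ λ x x∈ → ⊑-⋃ g i x (T⊑gi x x∈)
    ... | no  none       = inj₂ (⋃-⊑ g λ i →
            [ (λ T⊑gi → contradiction (i , T⊑gi) none) , id ]′ (comparable (s i) t))

    -- `True (em _)` squeezes the `Set₁`-valued `Tower S` into `Set`, so that `sup` can range over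
    -- all tower members missing `x`.
    Missing : A → Set
    Missing x = Σ Sub λ S → True (em _ {P = Tower S}) × ¬ x ∈ᵇ S

    below : A → Sub
    below x = ⋃ {I = Missing x} proj₁

    below-tower : ∀ x → Tower (below x)
    below-tower x = sup proj₁ λ (_ , t , _) → toWitness t

    below-irrefl : ∀ x → ¬ x ∈ᵇ below x
    below-irrefl x x∈ with (_ , _ , x∉S) , x∈S ← char⁻ x∈ = x∉S x∈S

    below-max : ∀ {S x} → Tower S → ¬ x ∈ᵇ S → S ⊑ below x
    below-max {S} s x∉S = ⊑-⋃ proj₁ (S , fromWitness s , x∉S)

    -- Otherwise `below x ⁺` would still miss `x`, against the maximality of `below x`. Hence
    -- `below` is injective and the order total.
    outside-below : ∀ x → outside (below x) ≡ x
    outside-below x = stable λ o≢x →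
      outside-∉ {below x} (below-irrefl x)
        (below-max (next (below-tower x))
          (λ x∈ → [ below-irrefl x , (λ x≡o → o≢x (sym x≡o)) ]′ (char⁻ x∈))
          (outside (below x)) (char⁺ (inj₂ refl)))

    _≺_ : A → A → Set
    x ≺ y = x ∈ᵇ below y

    ≺-trichotomous : ∀ x y → x ≺ y ⊎ x ≡ y ⊎ y ≺ x
    ≺-trichotomous x y with em _ {P = x ≺ y} | em _ {P = y ≺ x}
    ... | yes x≺y | _       = inj₁ x≺y
    ... | no  _   | yes y≺x = inj₂ (inj₂ y≺x)
    ... | no  x⊀y | no y⊀x  = inj₂ (inj₁ (begin
        x                  ≡⟨ outside-below x ⟨
        outside (below x)  ≡⟨ cong outside (⊑-antisym (below-max (below-tower x) y⊀x)
                                                       (below-max (below-tower y) x⊀y)) ⟩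
        outside (below y)  ≡⟨ outside-below y ⟩
        y                  ∎))
      where open ≡-Reasoning

    ≺-trans : ∀ {x y z} → x ≺ y → y ≺ z → x ≺ z
    ≺-trans {x} {y} {z} x≺y y≺z with comparable (below-tower y) (below-tower z)
    ... | inj₁ z⊑y = contradiction (z⊑y y y≺z) (below-irrefl y)
    ... | inj₂ y⊑z = y⊑z x x≺y

    -- A point `x` new in `S ⁺` has all its predecessors in `S`, since `S ⁺ ⊑ below x` would give
    -- `x ≺ x`.
    tower-acc : ∀ {S} → Tower S → ∀ x → x ∈ᵇ S → Acc _≺_ x
    tower-acc (next {S} s) x x∈ with em _ {P = x ∈ᵇ S}
    ... | yes x∈S = tower-acc s x x∈S
    ... | no  x∉S = acc λ {y} y≺x → tower-acc s y (below⊑S y y≺x)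
      where
      x≡o : x ≡ outside S
      x≡o = [ (λ x∈S → contradiction x∈S x∉S) , id ]′ (char⁻ x∈)
      below⊑S : below x ⊑ S
      below⊑S with next-compare (comparable s) (below-tower x)
      ... | inj₁ sub   = sub
      ... | inj₂ S⁺⊑bx = contradiction (S⁺⊑bx x (char⁺ (inj₂ x≡o))) (below-irrefl x)
    tower-acc (sup g t) x x∈ with i , x∈gi ← char⁻ x∈ = tower-acc (t i) x x∈gi

    ≺-wellFounded : WellFounded _≺_
    ≺-wellFounded x =
      tower-acc (next (below-tower x)) x (char⁺ (inj₂ (sym (outside-below x))))

    infix 4 _≼_

    _≼_ : A → A → Set
    x ≼ y = x ≺ y ⊎ x ≡ y

    ≼-trans : ∀ {x y z} → x ≼ y → y ≼ z → x ≼ z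
    ≼-trans (inj₁ x≺y)  (inj₁ y≺z)  = inj₁ (≺-trans x≺y y≺z)
    ≼-trans (inj₁ x≺y)  (inj₂ refl) = inj₁ x≺y
    ≼-trans (inj₂ refl) y≼z         = y≼z

    ≺-or-≽ : ∀ x y → x ≺ y ⊎ y ≼ x
    ≺-or-≽ x y with ≺-trichotomous x y
    ... | inj₁ x≺y         = inj₁ x≺y
    ... | inj₂ (inj₁ refl) = inj₂ (inj₂ refl)
    ... | inj₂ (inj₂ y≺x)  = inj₂ (inj₁ y≺x)

    UpTo : A → Pred A 0ℓ
    UpTo x y = y ≼ x

  -- Sets generated from a set of points

  data Code (A : Set) : Set where
    num  : ℕ → Code A
    atom : A → Code A
    pair : Code A → Code A → Code A

  data Over {A : Set} (S : Pred A 0ℓ) : Code A → Set where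
    num  : ∀ n → Over S (num n)
    atom : ∀ {a} → a ∈ S → Over S (atom a)
    pair : ∀ {c d} → Over S c → Over S d → Over S (pair c d)

  -- For infinite S this says that |G| ≤ |S|.  Counting codes over S instead of
  -- elements of S makes the notion closed under S-indexed unions by construction,
  -- so that the cardinal identity κ · κ = κ is never needed.
  Covers : {A B : Set} → Pred A 0ℓ → Pred B 0ℓ → Set
  Covers {A} {B} S G = ∃ λ (f : Code A → B) → ∀ {x} → x ∈ G → ∃ λ c → Over S c × f c ≡ x

  Thin : Pred Cantor 0ℓ → Set
  Thin S = ¬ Covers S (U {A = Cantor})

  over-mono : {A : Set} {S T : Pred A 0ℓ} → S ⊆ T → ∀ {c} → Over S c → Over T c
  over-mono S⊆T (num n)    = num n
  over-mono S⊆T (atom a∈)  = atom (S⊆T a∈)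
  over-mono S⊆T (pair p q) = pair (over-mono S⊆T p) (over-mono S⊆T q)

  covers-monoˡ : {A B : Set} {S T : Pred A 0ℓ} {G : Pred B 0ℓ} →
                 S ⊆ T → Covers S G → Covers T G
  covers-monoˡ S⊆T (f , cov) = f , λ x∈ → let c , o , eq = cov x∈ in c , over-mono S⊆T o , eq

  covers-monoʳ : {A B : Set} {S : Pred A 0ℓ} {G H : Pred B 0ℓ} →
                 G ⊆ H → Covers S H → Covers S G
  covers-monoʳ G⊆H (f , cov) = f , cov ∘ G⊆H

  covers-image : {A B C : Set} {S : Pred A 0ℓ} {G : Pred B 0ℓ} (h : B → C) →
                 Covers S G → Covers S (λ y → ∃ λ x → x ∈ G × y ≡ h x)
  covers-image h (f , cov) = h ∘ f ,
    λ { (x , x∈ , refl) → let c , o , eq = cov x∈ in c , o , cong h eq }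

  covers-｛｝ : {A B : Set} {S : Pred A 0ℓ} (x : B) → Covers S ｛ x ｝
  covers-｛｝ x = const x , λ eq → num 0 , num 0 , eq

  covers-ℕ : {A : Set} {S : Pred A 0ℓ} → Covers S (U {A = ℕ})
  covers-ℕ = (λ { (num n) → n ; _ → 0 }) , λ {n} _ → num n , num n , refl

  covers-self : (S : Subset) → Covers S S
  covers-self S = (λ { (atom x) → x ; _ → λ _ → false }) , λ {x} x∈ → atom x , atom x∈ , refl

  covers-empty : {A : Set} {S : Pred A 0ℓ} {G : Subset} → ¬ ∃ G → Covers S G
  covers-empty empty = (λ _ _ → false) , λ x∈ → contradiction (_ , x∈) empty

  -- A pair of codes names a point of the union: the first names the index `w`, the second the point
  -- within `G w`.
  covers-⋃ : {A B : Set} {S : Pred A 0ℓ} {W : Pred B 0ℓ} (G : B → Subset) →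
             Covers S W → (∀ w → w ∈ W → Covers S (G w)) →
             Covers S (λ x → ∃ λ w → w ∈ W × x ∈ G w)
  covers-⋃ {A} {B} {S} {W} G (f , cov) covG = h , λ { (w , w∈ , x∈) → hit w w∈ x∈ }
    where
    part : B → Code A → Cantor
    part w with em _ {P = w ∈ W}
    ... | yes w∈ = proj₁ (covG w w∈)
    ... | no  _  = λ _ _ → false
    part-covers : ∀ w → w ∈ W → ∀ {x} → x ∈ G w → ∃ λ c → Over S c × part w c ≡ x
    part-covers w w∈ with em _ {P = w ∈ W}
    ... | yes w∈′ = proj₂ (covG w w∈′)
    ... | no  w∉  = contradiction w∈ w∉
    h : Code A → Cantor
    h (pair c d) = part (f c) d
    h _          = λ _ → false
    hit : ∀ w → w ∈ W → ∀ {x} → x ∈ G w → ∃ λ c → Over S c × h c ≡ x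
    hit w w∈ x∈ with c , o , refl ← cov w∈ with d , p , eq ← part-covers _ w∈ x∈ =
      pair c d , pair o p , eq

  covers-⋃ℕ : {A : Set} {S : Pred A 0ℓ} (G : ℕ → Subset) →
              (∀ n → Covers S (G n)) → Covers S (λ x → ∃ λ n → x ∈ G n)
  covers-⋃ℕ {S = S} G covG =
    covers-monoʳ (λ (n , x∈) → n , tt , x∈) (covers-⋃ {S = S} {W = U} G covers-ℕ λ n _ → covG n)

  covers-insert : {A : Set} {S : Pred A 0ℓ} {G : Subset} (x : Cantor) →
                  Covers S G → Covers S (λ y → y ≡ x ⊎ y ∈ G)
  covers-insert {S = S} {G} x covG =
    covers-monoʳ [ (λ { refl → 0 , refl }) , (λ y∈ → 1 , y∈) ]′
      (covers-⋃ℕ (λ { zero → ｛ x ｝ ; (suc _) → G })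
                 λ { zero → covers-｛｝ x ; (suc _) → covG })

  module _ {A : Set} (a : A) (S : Pred A 0ℓ) where

    -- Hilbert's hotel: shifting the numerals by one frees `num 0` as a name for the extra atom `a`.
    fill : Code A → Code A
    fill (num zero)    = atom a
    fill (num (suc n)) = num n
    fill (atom x)      = atom x
    fill (pair c d)    = pair (fill c) (fill d)

    unfill : ∀ {c} → Over (λ x → x ∈ S ⊎ x ≡ a) c → ∃ λ d → Over S d × fill d ≡ c
    unfill (num n)                = num (suc n) , num (suc n) , refl
    unfill (atom {x} (inj₁ x∈S))  = atom x , atom x∈S , refl
    unfill (atom (inj₂ refl))     = num 0 , num 0 , refl
    unfill (pair p q)
      with c , o , refl ← unfill p
      with d , o′ , refl ← unfill q = pair c d , pair o o′ , refl

    covers-remove : {B : Set} {G : Pred B 0ℓ} →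
                    Covers (λ x → x ∈ S ⊎ x ≡ a) G → Covers S G
    covers-remove (f , cov) = f ∘ fill , λ x∈ →
      let c , o , eq = cov x∈
          d , o′ , eq′ = unfill o
      in d , o′ , trans (cong f eq′) eq

  serialize-num : ℕ → ℕᵇ → ℕᵇ
  serialize-num zero    z = 1+[2 z ]
  serialize-num (suc n) z = 2[1+ serialize-num n z ]

  -- The digits are written in front of the rest `z`, so that nested codes can be read off one after
  -- the other. Atoms leave no trace, which is harmless over an empty set.
  serialize : {A : Set} → Code A → ℕᵇ → ℕᵇ
  serialize (num n)    z = 1+[2 serialize-num n z ]
  serialize (atom _)   z = z
  serialize (pair c d) z = 2[1+ serialize c (serialize d z) ]

  serialize-num-injective : ∀ m n {y z} → serialize-num m y ≡ serialize-num n z → m ≡ n × y ≡ z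
  serialize-num-injective zero    zero    refl = refl , refl
  serialize-num-injective (suc m) (suc n) eq
    with refl , eq′ ← serialize-num-injective m n (2[1+_]-injective eq) = refl , eq′

  serialize-injective : {A : Set} {S : Pred A 0ℓ} → (∀ {x} → x ∉ S) →
                        ∀ {c d} → Over S c → Over S d →
                        ∀ {y z} → serialize c y ≡ serialize d z → c ≡ d × y ≡ z
  serialize-injective none (atom x∈) _        = contradiction x∈ none
  serialize-injective none _        (atom x∈) = contradiction x∈ none
  serialize-injective none (num m)  (num n) eq
    with refl , eq′ ← serialize-num-injective m n (1+[2_]-injective eq) = refl , eq′
  serialize-injective none (pair p q) (pair p′ q′) eq
    with refl , eq′ ← serialize-injective none p p′ (2[1+_]-injective eq)
    with refl , eq″ ← serialize-injective none q q′ eq′ = refl , eq″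

  -- Cantor's diagonal argument: without atoms, `serialize` numbers the codes injectively.
  empty-thin : {S : Subset} → (∀ {x} → x ∉ S) → Thin S
  empty-thin {S} none (f , cov) = contradiction (cov {diagonal} tt) undefinable
    where
    index : Code Cantor → ℕ
    index c = toℕ (serialize c zero)
    Off : ℕ → Set
    Off n = ∃ λ c → Over S c × index c ≡ n × f c n ≡ false
    diagonal : Cantor
    diagonal = char Off
    undefinable : ¬ ∃ λ c → Over S c × f c ≡ diagonal
    undefinable (c , o , eq) with f c (index c) in val
    ... | false with () ← trans (sym (char⁺ {P = Off} (c , o , refl , val)))
                                (trans (sym (cong (λ y → y (index c)) eq)) val)
    ... | true with d , p , same , off ← char⁻ {P = Off}
                      (trans (sym (cong (λ y → y (index c)) eq)) val)
               with refl ← proj₁ (serialize-injective none p o (toℕ-injective same))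
               with () ← trans (sym val) off

  -- A chain of thin sets whose codes exhaust the Cantor space

  open WellOrder {A = Cantor} (λ _ → false)

  Early : Pred Cantor 0ℓ
  Early x = Thin (_≺ x)

  early-upTo : ∀ {x} → Early x → Thin (UpTo x)
  early-upTo {x} thin cov = thin (covers-remove x (_≺ x) cov)

  -- If `Early` were thin, the first point outside it would have only early predecessors and so be
  -- early itself; if no point is outside, `Early` covers itself.
  early-covers : Covers Early (U {A = Cantor})
  early-covers = stable thin⇒⊥
    where
    thin⇒⊥ : ¬ Thin Early
    thin⇒⊥ thin with em _ {P = ∃ λ x → x ∉ Early}
    ... | no  none = thin (covers-monoˡ (λ {x} _ → stable λ x∉ → none (x , x∉)) (covers-self U))
    ... | yes ex with _ , x∉ , least ← minimal ≺-wellFounded (_∉ Early) ex =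
          x∉ λ cov → thin (covers-monoˡ (λ {y} y≺x → stable (least y y≺x)) cov)

  -- A code mentions finitely many atoms, so the last one bounds it; for a numeral the `≺`-least
  -- point serves.
  over-early : ∀ {c} → Over Early c → ∃ λ x → x ∈ Early × Over (UpTo x) c
  over-early (num n) with x , _ , least ← minimal ≺-wellFounded U ((λ _ → false) , tt) =
    x , empty-thin (λ {y} y≺x → least y y≺x tt) , num n
  over-early (atom {x} x∈) = x , x∈ , atom (inj₂ refl)
  over-early (pair p q) with x , x∈ , p′ ← over-early p | y , y∈ , q′ ← over-early q
    with ≺-or-≽ x y
  ... | inj₁ x≺y = y , y∈ , pair (over-mono (λ z≼x → ≼-trans z≼x (inj₁ x≺y)) p′) q′
  ... | inj₂ y≼x = x , x∈ , pair p′ (over-mono (λ z≼y → ≼-trans z≼y y≼x) q′)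

  opaque
    ranked : ∀ z → ∃ λ x → x ∈ Early × ∃ λ c → Over (UpTo x) c × proj₁ early-covers c ≡ z
    ranked z with c , o , eq ← proj₂ early-covers {z} tt
             with x , x∈ , o′ ← over-early o = x , x∈ , c , o′ , eq

  -- Some early bound on the atoms of one code for `z`, not claimed to be the least.
  rank : Cantor → Cantor
  rank z = proj₁ (ranked z)

  rank-thin : ∀ z → Thin (UpTo (rank z))
  rank-thin z = early-upTo (proj₁ (proj₂ (ranked z)))

  rank-covers : ∀ x → Covers (UpTo x) (λ z → rank z ≼ x)
  rank-covers x = proj₁ early-covers , λ {z} le →
    let _ , _ , c , o , eq = ranked z in c , over-mono (λ y≼ → ≼-trans y≼ le) o , eq

  -- Perfect sets

  ≢-≢⇒≡ : {b c d : Bool} → b ≢ c → b ≢ d → c ≡ d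
  ≢-≢⇒≡ b≢c b≢d = trans (¬-not (b≢c ∘ sym)) (sym (¬-not (b≢d ∘ sym)))

  agree-sym : ∀ {n x y} → Agree n x y → Agree n y x
  agree-sym p k k<n = sym (p k k<n)

  agree-trans : ∀ {n x y z} → Agree n x y → Agree n y z → Agree n x z
  agree-trans p q k k<n = trans (p k k<n) (q k k<n)

  agree-≤ : ∀ {m n x y} → m ≤ n → Agree n x y → Agree m x y
  agree-≤ m≤n p k k<m = p k (<-≤-trans k<m m≤n)

  agree-suc : ∀ {n x y} → Agree n x y → x n ≡ y n → Agree (suc n) x y
  agree-suc p eq k k<1+n with m≤n⇒m<n∨m≡n (≤-pred k<1+n)
  ... | inj₁ k<n  = p k k<n
  ... | inj₂ refl = eq

  first-difference : ∀ {x y} → x ≢ y → ∃ λ n → Agree n x y × x n ≢ y n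
  first-difference x≢y
    with n , differ , least ← minimal <-wellFounded _ (¬∀⇒∃¬ (x≢y ∘ ext _ _)) =
    n , (λ k k<n → stable (least k k<n)) , differ

  differ-beyond : ∀ {m n} {x y : Cantor} → Agree m x y → x n ≢ y n → m ≤ n
  differ-beyond agree differ = ≮⇒≥ λ n<m → differ (agree _ n<m)

  Splits : Subset → ℕ → Cantor → Set
  Splits P n x = ∀ b → ∃ λ y → y ∈ P × Agree n x y × y n ≡ b

  splits : ∀ {P n x y} → x ∈ P → y ∈ P → Agree n x y → x n ≢ y n → Splits P n x
  splits {n = n} {x} {y} x∈ y∈ agree differ b with x n ≟ᵇ b
  ... | yes eq = x , x∈ , (λ _ _ → refl) , eq
  ... | no  ne = y , y∈ , agree , ≢-≢⇒≡ differ ne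

  splits-resp : ∀ {P n x y} → Agree n x y → Splits P n x → Splits P n y
  splits-resp agree s b = let z , z∈ , agree′ , eq = s b in
    z , z∈ , agree-trans (agree-sym agree) agree′ , eq

  open Perfect

  branching : ∀ {P x} → Perfect P → x ∈ P → ∀ n →
              ∃ λ m → n ≤ m × ∃ λ y → y ∈ P × Agree m x y × x m ≢ y m
  branching perfect x∈ n with y , y∈ , y≢x , agree ← noIsolatedPoints perfect _ x∈ n
    with m , agree′ , differ ← first-difference (y≢x ∘ sym) =
    m , differ-beyond agree differ , y , y∈ , agree′ , differ

  SplitsIn : Subset → ℕ → ℕ → Cantor → Set
  SplitsIn P n M x = ∃ λ m → n ≤ m × m < M × Splits P m x

  -- König's lemma for the binary tree: a bound that is locally uniform near
  -- every point is uniform.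
  uniform-bound : ∀ {R : ℕ → Cantor → Set} → (∀ {M N x} → M ≤ N → R M x → R N x) →
                  ∀ n → (∀ x → ∃ λ M → ∀ y → Agree n x y → R M y) → ∃ λ M → ∀ y → R M y
  uniform-bound mono zero    local with M , r ← local (λ _ → false) = M , λ y → r y λ _ ()
  uniform-bound {R} mono (suc n) local = uniform-bound mono n local′
    where
    local′ : ∀ x → ∃ λ M → ∀ y → Agree n x y → R M y
    local′ x with M , r ← local x | em _ {P = ∃ λ z → Agree n x z × x n ≢ z n}
    ... | no  none = M , λ y agree → r y (agree-suc agree (stable λ ne → none (y , agree , ne)))
    ... | yes (z , agree , ne) with N , s ← local z = M ⊔ N , both
      where
      both : ∀ y → Agree n x y → R (M ⊔ N) y
      both y agree′ with x n ≟ᵇ y n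
      ... | yes eq  = mono (m≤m⊔n M N) (r y (agree-suc agree′ eq))
      ... | no  ne′ = mono (m≤n⊔m M N)
              (s y (agree-suc (agree-trans (agree-sym agree) agree′) (≢-≢⇒≡ ne ne′)))

  -- Splitting levels and pruning

  module _ {P : Subset} (perfect : Perfect P) where

    next-level : ∀ n → ∃ λ M → ∀ x → x ∈ P → SplitsIn P n M x
    next-level n = uniform-bound {λ M x → x ∈ P → SplitsIn P n M x}
      (λ M≤N r x∈ → let m , n≤m , m<M , s = r x∈ in m , n≤m , <-≤-trans m<M M≤N , s) n local
      where
      local : ∀ x → ∃ λ M → ∀ y → Agree n x y → y ∈ P → SplitsIn P n M y
      local x with em _ {P = ∃ λ y → Agree n x y × y ∈ P}
      ... | no  none = 0 , λ y agree y∈ → contradiction (y , agree , y∈) none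
      ... | yes (y , agree , y∈) with m , n≤m , z , z∈ , agree′ , ne ← branching perfect y∈ n =
        suc m , near
        where
        near : ∀ w → Agree n x w → w ∈ P → SplitsIn P n (suc m) w
        near w agree″ w∈ with em _ {P = Agree m w y}
        ... | yes w~y = m , n≤m , n<1+n m , splits-resp (agree-sym w~y) (splits y∈ z∈ agree′ ne)
        -- Here `w` leaves `y` no later than at `m`, and this first difference is itself a split of
        -- `w`.
        ... | no  w≁y with k , w~y , ne′ ← first-difference {w} {y} (λ { refl → w≁y λ _ _ → refl }) =
          k , differ-beyond (agree-trans (agree-sym agree″) agree) ne′ ,
          s≤s (≮⇒≥ λ m<k → w≁y (agree-≤ (<⇒≤ m<k) w~y)) , splits w∈ y∈ w~y ne′

    level : ℕ → ℕ
    level zero    = 0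
    level (suc k) = proj₁ (next-level (level k))

    level-splits : ∀ k {x} → x ∈ P → SplitsIn P (level k) (level (suc k)) x
    level-splits k = proj₂ (next-level (level k)) _

    level-suc : ∀ k → level k < level (suc k)
    level-suc k with _ , n≤m , m<M , _ ← level-splits k (proj₂ (nonempty perfect)) =
      ≤-<-trans n≤m m<M

    level-mono : ∀ {j k} → j ≤ k → level j ≤ level k
    level-mono {k = zero}  z≤n = ≤-refl
    level-mono {k = suc k} j≤1+k with m≤n⇒m<n∨m≡n j≤1+k
    ... | inj₁ j<1+k = ≤-trans (level-mono (≤-pred j<1+k)) (<⇒≤ (level-suc k))
    ... | inj₂ refl  = ≤-refl

    level-≥ : ∀ k → k ≤ level k
    level-≥ zero    = z≤n
    level-≥ (suc k) = ≤-<-trans (level-≥ k) (level-suc k)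

    InBlock : ℕ → ℕ → Set
    InBlock k n = level k ≤ n × n < level (suc k)

    block-unique : ∀ {j k n} → InBlock j n → InBlock k n → j ≡ k
    block-unique {j} {k} (lo , hi) (lo′ , hi′) with <-cmp j k
    ... | tri< j<k _ _ = contradiction (≤-trans (level-mono j<k) lo′) (<⇒≱ hi)
    ... | tri≈ _ eq _  = eq
    ... | tri> _ _ k<j = contradiction (≤-trans (level-mono k<j) lo) (<⇒≱ hi′)

    Frequent : Pred ℕ 0ℓ → Set
    Frequent A = ∀ {x} → x ∈ P → ∀ n → ∃ λ m → n ≤ m × A m × Splits P m x

    -- Splitting is measured in `P`, not in the pruned set: whether level `n` is constrained depends
    -- only on the bits below `n`, so the constraints can be met one level at a time.
    Prune : Pred ℕ 0ℓ → Cantor → Subset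
    Prune A d x = x ∈ P × ∀ n → ¬ A n → Splits P n x → x n ≡ d n

    module _ {A : Pred ℕ 0ℓ} {d : Cantor} where

      Deviates : ℕ → Cantor → Set
      Deviates n x = ¬ A n × Splits P n x × x n ≢ d n

      correct : ℕ → Σ Cantor P → Σ Cantor P
      correct n (x , x∈) with em _ {P = Deviates n x}
      ... | yes (_ , s , _) = proj₁ (s (d n)) , proj₁ (proj₂ (s (d n)))
      ... | no  _           = x , x∈

      correct-agree : ∀ n p → Agree n (proj₁ p) (proj₁ (correct n p))
      correct-agree n (x , x∈) with em _ {P = Deviates n x}
      ... | yes (_ , s , _) = proj₁ (proj₂ (proj₂ (s (d n))))
      ... | no  _           = λ _ _ → refl

      correct-¬deviates : ∀ n p → ¬ Deviates n (proj₁ (correct n p))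
      correct-¬deviates n (x , x∈) with em _ {P = Deviates n x}
      ... | yes (_ , s , _) = λ (_ , _ , ne) → ne (proj₂ (proj₂ (proj₂ (s (d n)))))
      ... | no  ¬dev        = ¬dev

      correct-fixes : ∀ n p → ¬ Deviates n (proj₁ p) → correct n p ≡ p
      correct-fixes n (x , x∈) ¬dev with em _ {P = Deviates n x}
      ... | yes dev = contradiction dev ¬dev
      ... | no  _   = refl

      -- Fusion: `correct k` repairs level `k` and keeps the bits below, so the stages converge to a
      -- point of the closed set `P`. The first `n` stages have nothing to repair.
      prune-extend : ∀ {x n} → x ∈ P → (∀ k → k < n → ¬ Deviates k x) →
                     ∃ λ y → y ∈ Prune A d × Agree n x y
      prune-extend {x} {n} x∈ ok =
        limit , (closed perfect limit (λ k → _ , proj₂ (stage k) , agree-sym (stage-limit k)) ,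
                 λ k k∉A s → stable λ ne → correct-¬deviates k (stage k)
                   (k∉A , splits-resp (agree-trans (agree-sym (stage-limit k))
                                                   (correct-agree k (stage k))) s , ne)) ,
        λ k k<n → cong (λ p → proj₁ p k) (sym (stage-fixed (suc k) k<n))
        where
        stage : ℕ → Σ Cantor P
        stage zero    = x , x∈
        stage (suc k) = correct k (stage k)
        limit : Cantor
        limit k = proj₁ (stage (suc k)) k
        stage-limit : ∀ k → Agree k (proj₁ (stage k)) limit
        stage-limit zero    = λ _ ()
        stage-limit (suc k) = agree-suc
          (agree-trans (agree-sym (correct-agree k (stage k))) (stage-limit k)) refl
        stage-fixed : ∀ k → k ≤ n → stage k ≡ (x , x∈)
        stage-fixed zero    _   = refl
        stage-fixed (suc k) k<n rewrite stage-fixed k (<⇒≤ k<n) = correct-fixes k (x , x∈) (ok k k<n)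

      prune-perfect : Frequent A → Perfect (Prune A d)
      prune-perfect frequent .nonempty with x , x∈ ← nonempty perfect
        with y , y∈ , _ ← prune-extend {n = 0} x∈ (λ _ ()) = y , y∈
      prune-perfect frequent .closed x approx =
        closed perfect x (λ n → let y , (y∈ , _) , agree = approx n in y , y∈ , agree) ,
        λ n n∉A s → let y , (_ , y-ok) , agree = approx (suc n) in
          trans (agree n (n<1+n n))
                (y-ok n n∉A (splits-resp (agree-≤ (n≤1+n n) agree) s))
      prune-perfect frequent .noIsolatedPoints x (x∈ , x-ok) n
        with m , n≤m , m∈A , s ← frequent x∈ n
        with y , y∈ , agree , flip ← s (not (x m))
        -- The bit at `m` may be flipped because `m` is in `A`; below `m`, the point `y` agrees with
        -- `x` and inherits its obedience to `d`.
        with z , z∈ , agree′ ← prune-extend {n = suc m} y∈ (λ k k<1+m (k∉A , s′ , ne) →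
               [ (λ k<m → ne (trans (sym (agree k k<m))
                   (x-ok k k∉A (splits-resp (agree-sym (agree-≤ (<⇒≤ k<m) agree)) s′))))
               , (λ { refl → k∉A m∈A }) ]′ (m≤n⇒m<n∨m≡n (≤-pred k<1+m))) =
        z , z∈ , (λ { refl → not-¬ {y = x m} refl (trans (sym (agree′ m (n<1+n m))) flip) }) ,
        agree-≤ n≤m (agree-trans agree (agree-≤ (n≤1+n m) agree′))

  -- Initial segments as numbers

  extend : Bool → ℕᵇ → ℕᵇ
  extend true  = 2[1+_]
  extend false = 1+[2_]

  -- The bits are digits of a bijective base-2 numeral, so the number determines the length as well.
  segment : ℕ → Cantor → ℕᵇ
  segment zero    x = zero
  segment (suc n) x = extend (x n) (segment n x)

  index : ℕ → Cantor → ℕ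
  index n x = toℕ (segment n x)

  extend-injective : ∀ b c {p q} → extend b p ≡ extend c q → b ≡ c × p ≡ q
  extend-injective true  true  refl = refl , refl
  extend-injective false false refl = refl , refl

  segment-injective : ∀ m n {x y} → segment m x ≡ segment n y → m ≡ n × Agree m x y
  segment-injective zero zero eq = refl , λ _ ()
  segment-injective zero (suc n) {y = y} eq with y n
  segment-injective zero (suc n) () | true
  segment-injective zero (suc n) () | false
  segment-injective (suc m) zero {x = x} eq with x m
  segment-injective (suc m) zero () | true
  segment-injective (suc m) zero () | false
  segment-injective (suc m) (suc n) eq
    with eq-bit , eq-rest ← extend-injective _ _ eq
    with refl , agree ← segment-injective m n eq-rest = refl , agree-suc agree eq-bit

  index-injective : ∀ m n {x y} → index m x ≡ index n y → m ≡ n × Agree m x y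
  index-injective m n eq = segment-injective m n (toℕ-injective eq)

  extend-< : ∀ b p → toℕ p < toℕ (extend b p)
  extend-< true  p = m≤n*m (suc (toℕ p)) 2
  extend-< false p = s≤s (m≤n*m (toℕ p) 2)

  index-≥ : ∀ n x → n ≤ index n x
  index-≥ zero    x = z≤n
  index-≥ (suc n) x = ≤-<-trans (index-≥ n x) (extend-< (x n) (segment n x))

  bounded-prefix : (f : ℕ → ℕ) (d : ℕ) → ∃ λ M → ∀ j → j ≤ d → f j ≤ M
  bounded-prefix f zero = f 0 , λ { zero z≤n → ≤-refl }
  bounded-prefix f (suc d) with M , bound ← bounded-prefix f d =
    M ⊔ f (suc d) , λ j j≤1+d →
      [ (λ j<1+d → ≤-trans (bound j (≤-pred j<1+d)) (m≤m⊔n M _))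
      , (λ { refl → m≤n⊔m M _ }) ]′ (m≤n⇒m<n∨m≡n j≤1+d)

  -- Almost disjoint sets of levels and disjoint perfect pieces

  DiffsIn : Subset → Pred ℕ 0ℓ → Set
  DiffsIn P A = ∀ {x y n} → x ∈ P → y ∈ P → Agree n x y → x n ≢ y n → A n

  module _ {P : Subset} (perfect : Perfect P) where

    prune-diffs : ∀ {A d} → DiffsIn (Prune perfect A d) A
    prune-diffs {A} (x∈ , x-ok) (y∈ , y-ok) agree differ = stable λ n∉A →
      let s = splits x∈ y∈ agree differ in
      differ (trans (x-ok _ n∉A s) (sym (y-ok _ n∉A (splits-resp agree s))))

    -- The sets Chosen r for distinct r meet in finite sets: their blocks are indexed
    -- by the initial segments of r.
    Chosen : Cantor → Pred ℕ 0ℓ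
    Chosen r n = ∃ λ j → InBlock perfect (index j r) n

    chosen-frequent : ∀ r → Frequent perfect (Chosen r)
    chosen-frequent r x∈ n with m , lo , hi , s ← level-splits perfect (index n r) x∈ =
      m , ≤-trans (≤-trans (index-≥ n r) (level-≥ perfect (index n r))) lo , (n , lo , hi) , s

    chosen-perfect : ∀ r {d} → Perfect (Prune perfect (Chosen r) d)
    chosen-perfect r = prune-perfect perfect (chosen-frequent r)

    -- A common level lies in one block, numbered by a common initial segment of `r` and `s`; such a
    -- segment ends by their first difference.
    chosen-almost-disjoint : ∀ {r s} → r ≢ s → ∃ λ M → ∀ n → Chosen r n → Chosen s n → n < M
    chosen-almost-disjoint {r} {s} r≢s
      with d , _ , differ ← first-difference r≢s
      with M , bound ← bounded-prefix (λ j → level perfect (suc (index j r))) d =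
      M , λ n (j , lo , hi) (k , in-k) →
        let _ , agree = index-injective j k (block-unique perfect (lo , hi) in-k)
        in <-≤-trans hi (bound j (differ-beyond agree differ))

    -- These blocks are reserved for writing down a point `r`. The `suc` skips the empty segment,
    -- whose block belongs to `Chosen (λ _ → false)`.
    marker : ℕ → ℕ
    marker k = index (suc k) (λ _ → true)

    marker-unchosen : ∀ k {n} → InBlock perfect (marker k) n → ¬ Chosen (λ _ → false) n
    marker-unchosen k in-k (j , in-j)
      with _ , agree ← index-injective (suc k) j {x = λ _ → true} {y = λ _ → false}
                         (block-unique perfect in-k in-j)
      with () ← agree 0 (s≤s z≤n)

    Marked : Cantor → Pred ℕ 0ℓ
    Marked r n = ∃ λ k → InBlock perfect (marker k) n × r k ≡ true

    -- Every point of `P` splits in every marker block, so a point of the piece reveals all of `r`;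
    -- the all-false blocks stay free and keep the piece perfect.
    Piece : Cantor → Subset
    Piece r = Prune perfect (Chosen (λ _ → false)) (char (Marked r))

    piece-value : ∀ {r x} → x ∈ Piece r → ∀ k {m} →
                  InBlock perfect (marker k) m → Splits P m x → x m ≡ r k
    piece-value {r} (x∈ , x-ok) k {m} in-k s = trans (x-ok m (marker-unchosen k in-k) s)
      (⇔⇒≡ (λ eq → let j , in-j , rj = char⁻ {P = Marked r} eq
                       same = proj₁ (index-injective (suc j) (suc k) {x = λ _ → true} {y = λ _ → true}
                                       (block-unique perfect in-j in-k))
                   in subst (λ i → r i ≡ true) (suc-injective same) rj)
            (λ rk → char⁺ {P = Marked r} (k , in-k , rk)))

    piece-disjoint : ∀ {r s x} → x ∈ Piece r → x ∈ Piece s → r ≡ s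
    piece-disjoint x∈r x∈s = ext _ _ λ k →
      let _ , lo , hi , sp = level-splits perfect (marker k) (proj₁ x∈r)
      in trans (sym (piece-value x∈r k (lo , hi) sp)) (piece-value x∈s k (lo , hi) sp)

  perfect-diffs-infinite : ∀ {Z A B} → Perfect Z → DiffsIn Z A → DiffsIn Z B →
                           ¬ ∃ λ M → ∀ n → A n → B n → n < M
  perfect-diffs-infinite perfect inA inB (M , bound)
    with x , x∈ ← nonempty perfect
    with m , M≤m , _ , y∈ , agree , differ ← branching perfect x∈ M =
    <⇒≱ (bound m (inA x∈ y∈ agree differ) (inB x∈ y∈ agree differ)) M≤m

  -- Cantor–Bendixson, with "covered by S" in place of "countable": the points
  -- all of whose neighbourhoods in D are uncovered form a perfect set.
  perfect-kernel : {A : Set} {S : Pred A 0ℓ} {D : Subset} →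
                   Closed D → ¬ Covers S D → ∃ λ Z → Perfect Z × Z ⊆ D
  perfect-kernel {S = S} {D} closedD uncovered = Kernel , kernel-perfect , kernel⊆D
    where
    Near : Cantor → ℕ → Subset
    Near x n y = y ∈ D × Agree n x y

    Kernel : Subset
    Kernel x = ∀ n → ¬ Covers S (Near x n)

    kernel⊆D : Kernel ⊆ D
    kernel⊆D {x} x∈ = closedD x λ n → stable λ none →
      x∈ n (covers-empty none)

    -- Grouping by `index n x` makes the union countable: all points of one group share a single
    -- covered neighbourhood.
    Light : ℕ → Subset
    Light k x = x ∈ D × ∃ λ n → index n x ≡ k × Covers S (Near x n)

    light-covered : ∀ k → Covers S (Light k)
    light-covered k with em _ {P = ∃ (Light k)}
    ... | no  none = covers-empty none
    ... | yes (x , _ , n , refl , cov) = covers-monoʳ (λ (y∈ , m , same , _) →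
            let m≡n , agree = index-injective m n same
            in y∈ , agree-sym (subst (λ i → Agree i _ x) m≡n agree)) cov

    rest-covered : Covers S (λ x → x ∈ D × x ∉ Kernel)
    rest-covered = covers-monoʳ (λ {x} (x∈ , x∉) →
      let n , ¬¬cov = ¬∀⇒∃¬ x∉ in index n x , x∈ , n , refl , stable ¬¬cov)
      (covers-⋃ℕ Light light-covered)

    kernel-perfect : Perfect Kernel
    kernel-perfect .nonempty = stable λ none →
      uncovered (covers-monoʳ (λ x∈ → x∈ , λ k → none (_ , k)) rest-covered)
    kernel-perfect .closed x approx n cov with y , y∈ , agree ← approx n =
      y∈ n (covers-monoʳ (λ (z∈ , agree′) → z∈ , agree-trans agree agree′) cov)
    kernel-perfect .noIsolatedPoints x x∈ n = stable λ none →
      x∈ n (covers-monoʳ (λ {y} → split none) (covers-insert x rest-covered))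
      where
      split : ¬ (∃ λ y → y ∈ Kernel × y ≢ x × Agree n x y) →
              ∀ {y} → y ∈ Near x n → y ≡ x ⊎ y ∈ D × y ∉ Kernel
      split none {y} (y∈ , agree) with em _ {P = y ≡ x}
      ... | yes y≡x = inj₁ y≡x
      ... | no  y≢x = inj₂ (y∈ , λ k → none (y , k , y≢x , agree))

  some-perfect : ∃ Perfect
  some-perfect with Z , perfect , _ ← perfect-kernel {D = U} (λ _ _ → tt) (rank-thin λ _ → false) =
    Z , perfect

  -- Coding perfect sets by points

  Body : Cantor → Subset
  Body w x = ∀ n → w (index n x) ≡ true

  opaque
    -- Here `w` is read as a set of nodes. When no perfect set fits into `Body w`, an arbitrary one
    -- is the default, so that every point codes a perfect set.
    perfect-below : ∀ w → ∃ λ P → Perfect P × (∀ {R} → Perfect R → R ⊆ Body w → P ⊆ Body w)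
    perfect-below w with em _ {P = ∃ λ P → Perfect P × P ⊆ Body w}
    ... | yes (P , perfect , sub) = P , perfect , λ _ _ {x} → sub {x}
    ... | no  none                = proj₁ some-perfect , proj₂ some-perfect ,
                                    λ perfect sub → contradiction (_ , perfect , λ {x} → sub {x}) none

  perfect-code : ∀ {R} → Perfect R → ∃ λ w → proj₁ (perfect-below w) ⊆ R
  perfect-code {R} perfect = w , λ {x} x∈ →
    closed perfect x λ n →
      let m , y , y∈ , same = char⁻ {P = Node} (proj₂ (proj₂ (perfect-below w)) perfect R⊆body x∈ n)
          m≡n , agree = index-injective m n same
      in y , y∈ , agree-sym (subst (λ i → Agree i y x) m≡n agree)
    where
    Node : ℕ → Set
    Node k = ∃ λ n → ∃ λ y → y ∈ R × index n y ≡ k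
    w : Cantor
    w = char Node
    R⊆body : R ⊆ Body w
    R⊆body {x} x∈ n = char⁺ {P = Node} (n , x , x∈ , refl)

  -- Translates

  ⊕-cancelʳ : ∀ x t → x ⊕ t ⊕ t ≡ x
  ⊕-cancelʳ x t = ext _ _ λ n → begin
    (x n xor t n) xor t n  ≡⟨ xor-assoc (x n) (t n) (t n) ⟩
    x n xor (t n xor t n)  ≡⟨ cong (x n xor_) (xor-same (t n)) ⟩
    x n xor false          ≡⟨ xor-identityʳ (x n) ⟩
    x n                    ∎
    where open ≡-Reasoning

  ⊕-cancelˡ : ∀ x z → x ⊕ (x ⊕ z) ≡ z
  ⊕-cancelˡ x z = ext _ _ λ n →
    trans (sym (xor-assoc (x n) (x n) (z n))) (cong (_xor z n) (xor-same (x n)))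

  ⊕-assoc : ∀ x y z → x ⊕ y ⊕ z ≡ x ⊕ (y ⊕ z)
  ⊕-assoc x y z = ext _ _ λ n → xor-assoc (x n) (y n) (z n)

  agree-⊕ : ∀ {n x y} t → Agree n x y → Agree n (x ⊕ t) (y ⊕ t)
  agree-⊕ t agree k k<n = cong (_xor t k) (agree k k<n)

  -- x ∈ Shift t P iff x ∈ P + t, since t = - t.
  Shift : Cantor → Subset → Subset
  Shift t P x = x ⊕ t ∈ P

  unshift : ∀ {P x} t → x ∈ P → x ⊕ t ∈ Shift t P
  unshift {P} {x} t = subst P (sym (⊕-cancelʳ x t))

  shift-flip : ∀ {Z P} t → Z ⊆ Shift t P → Shift t Z ⊆ P
  shift-flip {P = P} t sub {x} x∈ = subst P (⊕-cancelʳ x t) (sub x∈)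

  shift-closed : ∀ {P} t → Closed P → Closed (Shift t P)
  shift-closed t closedP x approx = closedP (x ⊕ t) λ n →
    let y , y∈ , agree = approx n in y ⊕ t , y∈ , agree-⊕ t agree

  shift-perfect : ∀ {P} t → Perfect P → Perfect (Shift t P)
  shift-perfect {P} t perfect .nonempty = let x , x∈ = nonempty perfect in x ⊕ t , unshift {P} t x∈
  shift-perfect t perfect .closed = shift-closed t (closed perfect)
  shift-perfect {P} t perfect .noIsolatedPoints x x∈ n
    with y , y∈ , y≢ , agree ← noIsolatedPoints perfect (x ⊕ t) x∈ n =
    y ⊕ t , unshift {P} t y∈ ,
    (λ eq → y≢ (trans (sym (⊕-cancelʳ y t)) (cong (_⊕ t) eq))) ,
    subst (λ v → Agree n v (y ⊕ t)) (⊕-cancelʳ x t) (agree-⊕ t agree)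

  shift-diffs : ∀ {P A} t → DiffsIn P A → DiffsIn (Shift t P) A
  shift-diffs t inA {x} {y} {n} x∈ y∈ agree differ =
    inA x∈ y∈ (agree-⊕ t agree) λ eq → differ (begin
      x n            ≡⟨ cong (λ v → v n) (⊕-cancelʳ x t) ⟨
      (x ⊕ t ⊕ t) n  ≡⟨ cong (_xor t n) eq ⟩
      (y ⊕ t ⊕ t) n  ≡⟨ cong (λ v → v n) (⊕-cancelʳ y t) ⟩
      y n            ∎)
    where open ≡-Reasoning

  diffs-mono : ∀ {P Q A} → P ⊆ Q → DiffsIn Q A → DiffsIn P A
  diffs-mono P⊆Q inA x∈ y∈ = inA (P⊆Q x∈) (P⊆Q y∈)

  -- Sizes of the traces of `X` on translates

  module _ (X : Subset) (size : HasSizeContinuum X) where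

    open Bijection size using (to; injective)

    uncovered : ∀ {S} → Thin S → ¬ Covers S X
    uncovered {S} thin cov =
      thin (covers-monoʳ (λ {z} _ → _ , proj₂ (to z) , sym (name-to z)) (covers-image name cov))
      where
      name : Cantor → Cantor
      name x with em _ {P = ∃ λ z → proj₁ (to z) ≡ x}
      ... | yes (z , _) = z
      ... | no  _       = x
      name-to : ∀ z → name (proj₁ (to z)) ≡ z
      name-to z with em _ {P = ∃ λ z′ → proj₁ (to z′) ≡ proj₁ (to z)}
      ... | yes (_ , eq) = injective eq
      ... | no  none     = contradiction (z , refl) none

    Large : Cantor → Subset → Set
    Large a Q = ∃ λ t → ¬ Covers (UpTo a) (X ∩ Shift t Q)

    large-≼ : ∀ {a b Q} → a ≼ b → Large b Q → Large a Q
    large-≼ a≼b (t , unc) = t , λ cov → unc (covers-monoˡ (λ y≼a → ≼-trans y≼a a≼b) cov)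

    large-shift : ∀ {a Z P} t → Z ⊆ Shift t P → Large a Z → Large a P
    large-shift {P = P} t sub (s , unc) = s ⊕ t , λ cov →
      unc (covers-monoʳ (λ {x} (x∈ , xs∈) → x∈ , subst P (⊕-assoc x s t) (sub {x ⊕ s} xs∈)) cov)

    large-mono : ∀ {a Q P} → Q ⊆ P → Large a Q → Large a P
    large-mono {P = P} Q⊆P (t , unc) = t , λ cov →
      unc (covers-monoʳ {H = X ∩ Shift t P} (λ {x} (x∈ , xt∈) → x∈ , Q⊆P {x ⊕ t} xt∈) cov)

    Homogeneous : Subset → Set₁
    Homogeneous P = ∀ {Q} → Perfect Q → Q ⊆ P → ∀ {a} → Large a P → Large a Q

    opaque
      -- Take `Q` to fail `Large a` for the least possible `a`. Below `a`, no perfect subset of `P`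
      -- fails; from `a` on, `Q` itself is not large.
      homogeneous-below : ∀ {P} → Perfect P → ∃ λ Q → Perfect Q × Q ⊆ P × Homogeneous Q
      homogeneous-below {P} perfect
        with em _ {P = ∃ λ a → ∃ λ Q → Perfect Q × Q ⊆ P × ¬ Large a Q}
      ... | no  none = P , perfect , id , λ {Q} perfectQ Q⊆P {a} _ →
              stable λ small → none (a , Q , perfectQ , (λ {x} → Q⊆P {x}) , small)
      ... | yes ex with a , (Q , perfectQ , Q⊆P , small) , least ← minimal ≺-wellFounded _ ex =
            Q , perfectQ , Q⊆P , λ {R} perfectR R⊆Q {b} large →
              stable λ small′ →
                [ (λ b≺a → least b b≺a (R , perfectR , (λ {x} x∈ → Q⊆P (R⊆Q x∈)) , small′))
                , (λ a≼b → small (large-≼ {Q = Q} a≼b large)) ]′ (≺-or-≽ b a)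

    value : Subset → Cantor → Bool
    value P = char λ a → Large a P

    -- `Large` quantifies over all translates and so ignores shifts, and `Z + t` is a perfect subset
    -- of `P`.
    value-shift : ∀ {P Z} → Homogeneous P → Perfect Z → ∀ t → Z ⊆ Shift t P → value Z ≡ value P
    value-shift {P} {Z} hom perfect t sub = ext _ _ λ a → ⇔⇒≡
      (λ eq → char⁺ (large-shift {Z = Z} {P} t (λ {x} → sub {x}) (char⁻ eq)))
      (λ eq → char⁺ (large-shift {Z = Shift t Z} {Z} t id
                (hom (shift-perfect t perfect) (λ {x} → shift-flip {Z} {P} t (λ {x} → sub {x}) {x})
                     (char⁻ eq))))

    -- From a refinement of perfect sets to `Y`

    Refinement : Set₁
    Refinement = ∀ {P} → Perfect P → ∃ λ Q → Perfect Q × Q ⊆ P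

    module _ (refine : Refinement) where

      member : Cantor → Subset
      member w = proj₁ (refine (proj₁ (proj₂ (perfect-below w))))

      Avoidable : Cantor → Set
      Avoidable z = ∃ λ x → x ∈ X × ∀ w → rank w ≼ rank z → x ⊕ z ∉ member w

      -- Otherwise `G` is the union of its traces on the forbidden translates; `rank-covers` bounds
      -- their number, so `G` would be covered.
      avoidable : ∀ {b z} {G : Subset} → G ⊆ X → rank z ≼ b → ¬ Covers (UpTo b) G →
                  (∀ w → rank w ≼ rank z → Covers (UpTo b) (G ∩ Shift z (member w))) → Avoidable z
      avoidable {b} {z} {G} G⊆X z≼b unc cov = stable λ none →
        unc (covers-monoʳ
          (λ {x} x∈ → stable λ free → none (x , G⊆X x∈ , λ w w≼z xz∈ → free (w , w≼z , x∈ , xz∈)))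
          (covers-⋃ (λ w → G ∩ Shift z (member w))
            (covers-monoˡ (λ y≼z → ≼-trans y≼z z≼b) (rank-covers (rank z))) cov))

      module _ (avoid : ∀ z → Avoidable z) where

        point : Cantor → Cantor
        point z = proj₁ (avoid z) ⊕ z

        Y : Subset
        Y y = ∃ λ z → y ≡ point z

        -- Only `z` of rank below that of the code `w` can have `point z` in `member w`. The pieces
        -- are disjoint, so each such `z` spoils at most one `r`, and thinness leaves some `r`
        -- unspoiled.
        Y-null : Y ∈ s₀
        Y-null P perfect with w , below⊆P ← perfect-code perfect
          with perfectQ , Q⊆ ← proj₂ (refine (proj₁ (proj₂ (perfect-below w)))) =
          Piece perfectQ r , chosen-perfect perfectQ _ , (λ x∈ → below⊆P (Q⊆ (proj₁ x∈))) ,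
          λ { y (y∈ , z , eq) → r∉ (y , (z , early z (subst (member w) eq (proj₁ y∈)) , eq) , y∈) }
          where
          EarlyPoint : Subset
          EarlyPoint y = ∃ λ z → rank z ≼ rank w × y ≡ point z
          Hit : Subset
          Hit r = ∃ λ y → y ∈ EarlyPoint × y ∈ Piece perfectQ r
          early : ∀ z → point z ∈ member w → rank z ≼ rank w
          early z y∈ = [ inj₁ , (λ w≼z → contradiction y∈ (proj₂ (proj₂ (avoid z)) w w≼z)) ]′
                         (≺-or-≽ (rank z) (rank w))
          piece-of : Cantor → Cantor
          piece-of y with em _ {P = ∃ λ r → y ∈ Piece perfectQ r}
          ... | yes (r , _) = r
          ... | no  _       = y
          piece-of-unique : ∀ {r y} → y ∈ Piece perfectQ r → r ≡ piece-of y
          piece-of-unique {r} {y} y∈ with em _ {P = ∃ λ r → y ∈ Piece perfectQ r}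
          ... | yes (_ , y∈′) = piece-disjoint perfectQ y∈ y∈′
          ... | no  none      = contradiction (r , y∈) none
          hit-covered : Covers (UpTo (rank w)) Hit
          hit-covered = covers-monoʳ (λ (y , y∈ , y∈r) → y , y∈ , piece-of-unique y∈r)
            (covers-image piece-of (covers-image point (rank-covers (rank w))))
          unhit : ∃ λ r → r ∉ Hit
          unhit = ¬∀⇒∃¬ λ all → rank-thin w (covers-monoʳ (λ {r} _ → all r) hit-covered)
          r : Cantor
          r = proj₁ unhit
          r∉ : r ∉ Hit
          r∉ = proj₂ unhit

        conclusion : ∃ λ Y → Y ∈ s₀ × X ⊞ Y ≐ U
        conclusion = Y , Y-null , (λ _ → tt) , λ {z} _ →
          let x , x∈ , _ = avoid z in x , x ⊕ z , x∈ , (z , refl) , sym (⊕-cancelˡ x z)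

    -- The uniformly small case

    UniformlySmall : Cantor → Set₁
    UniformlySmall a = ∀ {P} → Perfect P → ∃ λ Q → Perfect Q × Q ⊆ P × ¬ Large a Q

    -- The bound is the larger of `a` and `rank z`: thin either way, and late enough to cover the
    -- traces on all members.
    small-case : ∀ {a} → Thin (UpTo a) → UniformlySmall a → ∃ λ Y → Y ∈ s₀ × X ⊞ Y ≐ U
    small-case {a} thin small = conclusion refine λ z →
      [ (λ z≺a → avoidable refine id (inj₁ z≺a) (uncovered thin)
                   (λ w _ → covered w z (inj₂ refl)))
      , (λ a≼z → avoidable refine id (inj₂ refl) (uncovered (rank-thin z))
                   (λ w _ → covered w z a≼z)) ]′ (≺-or-≽ (rank z) a)
      where
      refine : Refinement
      refine perfect = let Q , perfectQ , Q⊆P , _ = small perfect in Q , perfectQ , λ {x} → Q⊆P {x}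
      covered : ∀ w z {b} → a ≼ b → Covers (UpTo b) (X ∩ Shift z (member refine w))
      covered w z a≼b = covers-monoˡ (λ y≼a → ≼-trans y≼a a≼b)
        (stable λ unc → proj₂ (proj₂ (proj₂ (small (proj₁ (proj₂ (perfect-below w)))))) (z , unc))

    -- The large case

    module _ (large : ∀ {a} → Thin (UpTo a) →
                      ∃ λ P → Perfect P × ∀ {Q} → Perfect Q → Q ⊆ P → Large a Q) where

      Typical : (Cantor → Bool) → Subset → Set₁
      Typical v P = Perfect P × Homogeneous P × value P ≡ v

      opaque
        -- One fixed representative per value lets all sets of value `v` refer to the same almost
        -- disjoint family. For values not attained, `some-perfect` is a filler.
        typical : ∀ v → ∃ λ P → Perfect P × (∃ (Typical v) → Typical v P)
        typical v with em _ {P = ∃ (Typical v)}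
        ... | yes (P , t) = P , proj₁ t , λ _ → t
        ... | no  none    = proj₁ some-perfect , proj₂ some-perfect , λ ex → contradiction ex none

      Family : (Cantor → Bool) → Cantor → Pred ℕ 0ℓ
      Family v = Chosen (proj₁ (proj₂ (typical v)))

      Meets : Subset → Cantor → Set₁
      Meets Q r = ∃ λ Z → Perfect Z × Z ⊆ Q × DiffsIn Z (Family (value Q) r)

      opaque
        -- Passing to a `Z` with differences in family member `s` rules out every other `r`: a
        -- perfect subset would branch at unboundedly high levels common to both. By homogeneity the
        -- value, and with it the family, stays the same.
        refine-typical : ∀ {P} → Perfect P →
                  ∃ λ Q → Perfect Q × Q ⊆ P × Homogeneous Q × ∃ λ s → ∀ r → r ≢ s → ¬ Meets Q r
        refine-typical perfect with H , perfectH , H⊆P , hom ← homogeneous-below perfect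
          with em _ {P = ∃ (Meets H)}
        ... | no  none = H , perfectH , H⊆P , hom , (λ _ → false) , λ r _ m → none (r , m)
        ... | yes (s , Z , perfectZ , Z⊆H , diffs) =
              Z , perfectZ , (λ x∈ → H⊆P (Z⊆H x∈)) , hom′ , s , only-s
          where
          hom′ : Homogeneous Z
          hom′ perfectQ Q⊆Z l = hom perfectQ (λ x∈ → Z⊆H (Q⊆Z x∈))
              (large-mono {Q = Z} {H} (λ {x} → Z⊆H {x}) l)
          same-value : value Z ≡ value H
          same-value = ext _ _ λ a → ⇔⇒≡
              (λ eq → char⁺ (large-mono {Q = Z} {H} (λ {x} → Z⊆H {x}) (char⁻ eq)))
              (λ eq → char⁺ (hom perfectZ Z⊆H (char⁻ eq)))
          only-s : ∀ r → r ≢ s → ¬ Meets Z r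
          only-s r r≢s (W , perfectW , W⊆Z , diffsW) =
            perfect-diffs-infinite {W} perfectW
              (subst (λ v → DiffsIn W (Family v r)) same-value diffsW)
              (diffs-mono {W} {Z} W⊆Z diffs)
              (chosen-almost-disjoint (proj₁ (proj₂ (typical (value H)))) r≢s)

      refine : Refinement
      refine perfect = let Q , perfectQ , Q⊆P , _ = refine-typical perfect
                       in Q , perfectQ , λ {x} → Q⊆P {x}

      member-typical : ∀ w → Perfect (member refine w) × Homogeneous (member refine w) ×
                       ∃ λ s → ∀ r → r ≢ s → ¬ Meets (member refine w) r
      member-typical w =
        let _ , perfectQ , _ , rest = refine-typical (proj₁ (proj₂ (perfect-below w)))
        in perfectQ , rest

      Branch : (Cantor → Bool) → Cantor → Subset
      Branch v r = Prune (proj₁ (proj₂ (typical v))) (Family v r) (λ _ → false)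

      branch-perfect : ∀ v r → Perfect (Branch v r)
      branch-perfect v r = chosen-perfect (proj₁ (proj₂ (typical v))) r

      -- Translations preserve the levels of first differences. Comparing `Z` with both homogeneous
      -- sets by `value-shift` shows that `R` uses the family of `v`.
      overlap-meets : ∀ {v r R Z} t z →
                      Typical v (proj₁ (typical v)) → Homogeneous R → Perfect Z →
                      Z ⊆ Shift t (Branch v r) → Z ⊆ Shift z R → Meets R r
      overlap-meets {v} {r} {R} {Z} t z (_ , homM , valueM) homR perfectZ inBranch inR =
        Shift z Z , shift-perfect z perfectZ , (λ {x} → shift-flip {Z} {R} z (λ {y} → inR {y}) {x}) ,
        subst (λ u → DiffsIn (Shift z Z) (Family u r)) same-value
          (shift-diffs {Z} z (diffs-mono {Z} {Shift t (Branch v r)} (λ {y} → inBranch {y})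
            (shift-diffs {Branch v r} t (prune-diffs (proj₁ (proj₂ (typical v)))))))
        where
        same-value : v ≡ value R
        same-value = begin
          v                         ≡⟨ valueM ⟨
          value (proj₁ (typical v)) ≡⟨ value-shift homM perfectZ t (λ {y} y∈ → proj₁ (inBranch {y} y∈)) ⟨
          value Z                   ≡⟨ value-shift homR perfectZ z (λ {y} → inR {y}) ⟩
          value R                   ∎
          where open ≡-Reasoning

      overlap-covered : ∀ {S : Subset} {v r R} t z →
                        Typical v (proj₁ (typical v)) → Perfect R → Homogeneous R →
                        ¬ Meets R r → Covers S (Shift t (Branch v r) ∩ Shift z R)
      overlap-covered {v = v} {r} {R} t z typ perfectR homR ¬meets = stable λ unc →
        let Z , perfectZ , Z⊆ = perfect-kernel {D = Overlap} overlap-closed unc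
        in ¬meets (overlap-meets {v} {r} {R} {Z} t z typ homR perfectZ
                    (λ {x} x∈ → proj₁ (Z⊆ {x} x∈)) (λ {x} x∈ → proj₂ (Z⊆ {x} x∈)))
        where
        Overlap : Subset
        Overlap = Shift t (Branch v r) ∩ Shift z R
        overlap-closed : Closed Overlap
        overlap-closed x approx =
          shift-closed {Branch v r} t (closed (branch-perfect v r)) x
            (λ n → let y , y∈ , agree = approx n in y , proj₁ y∈ , agree) ,
          shift-closed {R} z (closed perfectR) x
            (λ n → let y , y∈ , agree = approx n in y , proj₂ y∈ , agree)

      -- The set provided by `large` need not be a representative, but its value records largeness
      -- at `a`; homogeneity hands this on to every branch of the representative.
      large-branch : ∀ {a} → Thin (UpTo a) →
                     ∃ λ v → Typical v (proj₁ (typical v)) × ∀ r → Large a (Branch v r)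
      large-branch {a} thin
        with P , perfectP , large-in-P ← large thin
        with H , perfectH , H⊆P , homH ← homogeneous-below perfectP =
        value H , typ , λ r → proj₁ (proj₂ typ) (branch-perfect (value H) r) proj₁
          (char⁻ (trans (cong (λ f → f a) (proj₂ (proj₂ typ)))
                        (char⁺ (large-in-P perfectH λ {x} → H⊆P {x}))))
        where
        typ : Typical (value H) (proj₁ (typical (value H)))
        typ = proj₂ (proj₂ (typical (value H))) (H , perfectH , homH , refl)

      exception : Cantor → Cantor
      exception w = proj₁ (proj₂ (proj₂ (member-typical w)))

      -- Each `w` excludes a single `r`, and the `w` in question are covered by a thin set.
      fresh : ∀ z → ∃ λ r → ∀ w → rank w ≼ rank z → r ≢ exception w
      fresh z = let r , r∉ = ¬∀⇒∃¬ not-all in r , λ w w≼z eq → r∉ (w , w≼z , eq)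
        where
        not-all : ¬ (∀ r → ∃ λ w → rank w ≼ rank z × r ≡ exception w)
        not-all all = rank-thin z
          (covers-monoʳ (λ {r} _ → all r) (covers-image exception (rank-covers (rank z))))

      large-avoidable : ∀ z → Avoidable refine z
      large-avoidable z
        with v , typ , large-in ← large-branch (rank-thin z)
        with r , r-fresh ← fresh z
        with t , unc ← large-in r =
        avoidable refine {G = X ∩ Shift t (Branch v r)} proj₁ (inj₂ refl) unc λ w w≼z →
          let perfectR , homR , only = member-typical w
          in covers-monoʳ {H = Shift t (Branch v r) ∩ Shift z (member refine w)}
               (λ {x} x∈ → proj₂ (proj₁ x∈) , proj₂ x∈)
               (overlap-covered {v = v} {r} {member refine w} t z typ perfectR homR
                 (proj₂ only r (r-fresh w w≼z)))

      large-case : ∃ λ Y → Y ∈ s₀ × X ⊞ Y ≐ U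
      large-case = conclusion refine large-avoidable

    not-shiftable : (¬ (X ∈ Shiftable s₀)) × (∃ λ Y → Y ∈ s₀ × X ⊞ Y ≐ U)
    not-shiftable = (λ shiftable → let Y , null , all = existence in shiftable Y null all) , existence
      where
      existence : ∃ λ Y → Y ∈ s₀ × X ⊞ Y ≐ U
      existence with em _ {P = ∃ λ a → Thin (UpTo a) × UniformlySmall a}
      ... | yes (a , thin , small) = small-case thin small
      ... | no  none               = large-case λ {a} thin → stable λ ¬ex →
        none (a , thin , λ {P} perfect → stable λ ¬small → ¬ex
          (P , perfect , λ {Q} perfectQ Q⊆P → stable λ ¬large →
            ¬small (Q , perfectQ , (λ {x} → Q⊆P {x}) , ¬large)))

theorem1p1 : (∀ ℓ → ExcludedMiddle ℓ) →
    (∀ a b → Extensionality a b) →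
    (X : Subset) → HasSizeContinuum X →
    (¬ (X ∈ Shiftable s₀)) × (∃ λ Y → Y ∈ s₀ × X ⊞ Y ≐ U)
theorem1p1 = not-shiftable
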